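{- Let $p,q,r,s\in\{0,1\}$ and let $n\ge 1$. The resolution calculus for the logic of confluence $\mathsf{K}_{(n)}^{p,q,r,s}$ is sound: for every finite set $\mathcal{T}$ of clauses, if $\mathcal{T}$ is satisfiable in $\mathsf{K}_{(n)}^{p,q,r,s}$, then every set of clauses occurring in any derivation from $\mathcal{T}$ in the calculus for $\mathsf{K}_{(n)}^{p,q,r,s}$ is satisfiable in $\mathsf{K}_{(n)}^{p,q,r,s}$; in particular, if a contradiction can be derived from $\mathcal{T}$, then $\mathcal{T}$ is unsatisfiable in $\mathsf{K}_{(n)}^{p,q,r,s}$.
   Context: **Syntax.** Let $\mathcal{A}_n=\{1,\dots,n\}$ be a finite set of agents and $\mathcal{P}$ a denumerable set of propositional symbols. Formulae are built from $\mathcal{P}$, $\mathbf{true}$, a nullary connective $\mathbf{start}$, $\neg$, $\wedge$ and unary modal operators $\Box_a$ ($a\in\mathcal{A}_n$), with the usual abbreviations $\mathbf{false},\vee,\Rightarrow$ and $\Diamond_a=\neg\Box_a\neg$. A literal is a propositional symbol or its negation; for a literal $l$, $\neg l$ denotes its complement (so $\neg\neg p$ is $p$). **Semantics.** A Kripke model is $\mathcal{M}=(\mathcal{W},w_0,\mathcal{R}_1,\dots,\mathcal{R}_n,\pi)$ with $\mathcal{W}$ a set of worlds, $w_0\in\mathcal{W}$ a distinguished world, $\mathcal{R}_a\subseteq\mathcal{W}\times\mathcal{W}$, and $\pi$ assigning to each world a truth assignment on $\mathcal{P}$. Satisfaction at a world is the usual Kripke one; $\mathbf{start}$ holds at $w$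 iff $w=w_0$. The universal operator $\Box^*$ is such that $\Box^*\varphi$ holds at $w$ iff $\varphi$ holds at $w$ and at every world reachable from $w$ by a finite path of steps in $\mathcal{R}_1\cup\dots\cup\mathcal{R}_n$. **Logics.** $\mathsf{K}_{(n)}^{p,q,r,s}$ is the normal multimodal logic $\mathsf{K}_{(n)}$ plus the axioms $\mathbf{G}_a^{p,q,r,s}:\ \Diamond_a^p\Box_a^q\varphi\Rightarrow\Box_a^r\Diamond_a^s\varphi$ for all $a\in\mathcal{A}_n$. Its models are the Kripke models such that for each $a\in\mathcal{A}_n$: for all $u_0,u_1,u_2\in\mathcal{W}$, if $u_0\mathcal{R}_a^p u_1$ and $u_0\mathcal{R}_a^r u_2$ then there is $u_3$ with $u_1\mathcal{R}_a^q u_3$ and $u_2\mathcal{R}_a^s u_3$ (here $\mathcal{R}_a^0$ is equality and $\mathcal{R}_a^1=\mathcal{R}_a$). **Clauses.** A clause is $\Box^*A$ where $A$ has one of the forms: initial clause $\mathbf{start}\Rightarrow\bigvee_b l_b$; literal clause $\mathbf{true}\Rightarrow\bigvee_b l_b$; positive $a$-clause $l'\Rightarrow\Box_a l$; negative $a$-clause $l'\Rightarrow\neg\Box_a l$ (with $l,l',l_b$ literals, finite disjunctions, the empty disjunction being $\mathbf{false}$). A set of clauses is satisfiable in $\mathsf{K}_{(n)}^{p,q,r,s}$ if there is a model of that logic in which all its clauses hold at $w_0$; otherwise it is unsatisfiable. Below $\Box^*$ is suppressed. Clauses are simplified by standard classical simplification (e.g. $D\vee l\vee l$ becomes $D\vee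 l$), and are considered modulo this simplification. **Definition clauses.** Let $\mathcal{L}(\mathcal{T})$ be the set of literals $x,\neg x$ with $x$ a propositional symbol occurring in $\mathcal{T}$. For each $l\in\mathcal{L}(\mathcal{T})$ and each agent $a$ occurring in $\mathcal{T}$, $pos_{a,l}$ is a new propositional symbol (definition symbol), with definition clauses $pos_{a,l}\Rightarrow\neg\Box_a\neg l$ and $\neg pos_{a,l}\Rightarrow\Box_a\neg l$. These are the only definition symbols used: a rule is not applied if its conclusion would contain another one, in particular a nested symbol such as $pos_{a,pos_{a,l}}$. **Rules for $\mathsf{K}_{(n)}$** ($D,D'$ disjunctions of literals, all other letters literals, premises separated by semicolons, conclusion after $\vdash$): - IRES1: $\mathbf{true}\Rightarrow D\vee l;\ \mathbf{start}\Rightarrow D'\vee\neg l\ \vdash\ \mathbf{start}\Rightarrow D\vee D'$. - IRES2: $\mathbf{start}\Rightarrow D\vee l;\ \mathbf{start}\Rightarrow D'\vee\neg l\ \vdash\ \mathbf{start}\Rightarrow D\vee D'$. - LRES: $\mathbf{true}\Rightarrow D\vee l;\ \mathbf{true}\Rightarrow D'\vee\neg l\ \vdash\ \mathbf{true}\Rightarrow D\vee D'$. - MRES: $l_1\Rightarrow\Box_a l;\ l_2\Rightarrow\neg\Box_a l\ \vdash\ \mathbf{true}\Rightarrow\neg l_1\vee\neg l_2$. - NEC1 ($m\ge0$): $l_1'\Rightarrow\Box_a\neg l_1;\dots;l_m'\Rightarrow\Box_a\neg l_m;\ l'\Rightarrow\neg\Box_a l;\ \mathbf{true}\Rightarrow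 l_1\vee\dots\vee l_m\vee l\ \vdash\ \mathbf{true}\Rightarrow\neg l_1'\vee\dots\vee\neg l_m'\vee\neg l'$. - NEC2: $l_1'\Rightarrow\Box_a l_1;\ l_2'\Rightarrow\Box_a\neg l_1;\ l_3'\Rightarrow\neg\Box_a l_2\ \vdash\ \mathbf{true}\Rightarrow\neg l_1'\vee\neg l_2'\vee\neg l_3'$. - NEC3 ($m\ge1$): $l_1'\Rightarrow\Box_a\neg l_1;\dots;l_m'\Rightarrow\Box_a\neg l_m;\ l'\Rightarrow\neg\Box_a l;\ \mathbf{true}\Rightarrow l_1\vee\dots\vee l_m\ \vdash\ \mathbf{true}\Rightarrow\neg l_1'\vee\dots\vee\neg l_m'\vee\neg l'$. **Additional rules for $\mathsf{K}_{(n)}^{p,q,r,s}$**, depending on $(p,q,r,s)$ (the tuples $(p,q,r,s)$ and $(r,s,p,q)$ define the same logic and share their rules): - $(0,0,0,1)$ or $(0,1,0,0)$ [T]: $\mathbf{true}\Rightarrow D\vee l\ \vdash\ \neg D\Rightarrow\neg\Box_a\neg l$; and $l\Rightarrow\Box_a l'\ \vdash\ \mathbf{true}\Rightarrow\neg l\vee l'$. - $(0,0,1,0)$ or $(1,0,0,0)$ [Ban]: $\mathbf{true}\Rightarrow D\vee l\ \vdash\ \neg D\Rightarrow\Box_a l$; and $l\Rightarrow\neg\Box_a\neg l'\ \vdash\ \mathbf{true}\Rightarrow\neg l\vee l'$. - $(0,0,1,1)$ or $(1,1,0,0)$ [B]: $\mathbf{true}\Rightarrow D\vee l\ \vdash\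 \neg D\Rightarrow\Box_a pos_{a,l}$; and $l\Rightarrow\Box_a l'\ \vdash\ \neg l'\Rightarrow\Box_a\neg l$. - $(0,1,0,1)$ [D]: $l\Rightarrow\Box_a l'\ \vdash\ l\Rightarrow\neg\Box_a\neg l'$. - $(0,1,1,1)$ or $(1,1,0,1)$: $l\Rightarrow\Box_a l'\ \vdash\ l\Rightarrow\Box_a pos_{a,l'}$; and $l\Rightarrow\Box_a l'\ \vdash\ pos_{a,l}\Rightarrow\neg\Box_a\neg l'$. - $(1,0,1,0)$ [F]: $l\Rightarrow\neg\Box_a\neg l'\ \vdash\ l\Rightarrow\Box_a l'$. - $(1,0,1,1)$ or $(1,1,1,0)$ [5]: $l\Rightarrow\neg\Box_a\neg l'\ \vdash\ l\Rightarrow\Box_a pos_{a,l'}$; and $l\Rightarrow\Box_a l'\ \vdash\ pos_{a,l}\Rightarrow\Box_a l'$. - $(1,1,1,1)$ [G1]: $l\Rightarrow\Box_a l'\ \vdash\ pos_{a,l}\Rightarrow\Box_a pos_{a,l'}$. - $(0,0,0,0),(0,1,1,0),(1,0,0,1)$ (the axiom is a tautology): no additional rules. **Derivations.** A derivation from $\mathcal{T}$ is a sequence $\mathcal{T}_0,\mathcal{T}_1,\dots$ where $\mathcal{T}_0$ is $\mathcal{T}$ together with the definition clauses, and $\mathcal{T}_i$ results from adding to $\mathcal{T}_{i-1}$ the conclusion of an application of a rule for $\mathsf{K}_{(n)}$ or an additional rule for $\mathsf{K}_{(n)}^{p,q,r,s}$ to clauses in $\mathcal{T}_{i-1}$. A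 contradiction is a clause $\Box^*(\mathbf{start}\Rightarrow\mathbf{false})$ or $\Box^*(\mathbf{true}\Rightarrow\mathbf{false})$. -}

module Defs where

open import Data.Fin using (Fin)
open import Data.Fin.Patterns using (0F; 1F)
open import Data.List using (List; []; _∷_; _++_; [_]; map; concatMap; foldr; cartesianProductWith)
open import Data.List.Membership.Propositional using (_∈_; _∉_)
open import Data.List.Relation.Binary.BagAndSetEquality using (_∼[_]_; set)
open import Data.List.Relation.Unary.All using (All)
open import Data.List.Relation.Unary.Any using (Any)
open import Data.Nat using (ℕ)
open import Data.Product using (Σ; ∃-syntax; _×_; _,_; proj₁; proj₂)
open import Data.Sum using (_⊎_)
open import Data.Unit using (⊤)
open import Level using (0ℓ)
open import Relation.Binary using (Rel)
open import Relation.Binary.Construct.Closure.ReflexiveTransitive using (Star)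
open import Relation.Binary.PropositionalEquality using (_≡_)
open import Relation.Nullary using (¬_; Stable)

Symbol : Set
Symbol = ℕ

data Formula (n : ℕ) : Set where
  atom  : Symbol → Formula n
  true  : Formula n
  start : Formula n
  ¬′_   : Formula n → Formula n
  _∧_   : Formula n → Formula n → Formula n
  □     : Fin n → Formula n → Formula n

infix  9 ¬′_
infixr 7 _∧_

module _ {n : ℕ} where

  infixr 6 _∨_
  infixr 5 _⇒_

  false : Formula n
  false = ¬′ true

  _∨_ : Formula n → Formula n → Formula n
  φ ∨ ψ = ¬′ (¬′ φ ∧ ¬′ ψ)

  _⇒_ : Formula n → Formula n → Formula n
  φ ⇒ ψ = ¬′ (φ ∧ ¬′ ψ)

-- Truth values are the ¬¬-stable propositions, so that the semantics is the
-- classical one without assuming excluded middle; under excluded middle they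
-- are exactly the booleans.  The connectives of Formula preserve stability,
-- start (which is an identity of worlds) being the only possibly unstable
-- formula former.
record KripkeModel (n : ℕ) : Set₁ where
  field
    World  : Set
    w₀     : World
    R      : Fin n → Rel World 0ℓ
    π      : World → Symbol → Set
    stable : ∀ w x → Stable (π w x)

module _ {n : ℕ} (M : KripkeModel n) where
  open KripkeModel M

  infix 4 _⊨_ _⊨□*_

  _⊨_ : World → Formula n → Set
  w ⊨ atom x  = π w x
  w ⊨ true    = ⊤
  w ⊨ start   = w ≡ w₀
  w ⊨ ¬′ φ    = ¬ (w ⊨ φ)
  w ⊨ φ ∧ ψ   = (w ⊨ φ) × (w ⊨ ψ)
  w ⊨ □ a φ   = ∀ v → R a w v → v ⊨ φ

  Reachable : Rel World 0ℓ
  Reachable = Star (λ u v → ∃[ a ] R a u v)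

  _⊨□*_ : World → Formula n → Set
  w ⊨□* φ = ∀ v → Reachable w v → v ⊨ φ

infix 8 _^_

_^_ : {W : Set} → Rel W 0ℓ → Fin 2 → Rel W 0ℓ
S ^ 0F = _≡_
S ^ 1F = S

Confluent : {n : ℕ} → (p q r s : Fin 2) → KripkeModel n → Set
Confluent p q r s M = ∀ a u₀ u₁ u₂ → (R a ^ p) u₀ u₁ → (R a ^ r) u₀ u₂ →
                      ∃[ u₃ ] (R a ^ q) u₁ u₃ × (R a ^ s) u₂ u₃
  where open KripkeModel M

data Literal : Set where
  var  : Symbol → Literal
  nvar : Symbol → Literal

infix 9 ∼_

∼_ : Literal → Literal
∼ var x  = nvar x
∼ nvar x = var x

symbol : Literal → Symbol
symbol (var x)  = x
symbol (nvar x) = x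

Disjunction : Set
Disjunction = List Literal

-- Only the matrix A of a clause □* A is recorded.
data Clause (n : ℕ) : Set where
  initial  : Disjunction → Clause n                 -- start ⇒ ⋁ D
  literal  : Disjunction → Clause n                 -- true ⇒ ⋁ D
  positive : Fin n → Literal → Literal → Clause n   -- positive a l′ l  is  l′ ⇒ □ₐ l
  negative : Fin n → Literal → Literal → Clause n   -- negative a l′ l  is  l′ ⇒ ¬ □ₐ l

module _ {n : ℕ} where

  litF : Literal → Formula n
  litF (var x)  = atom x
  litF (nvar x) = ¬′ atom x

  ⋁ : Disjunction → Formula n
  ⋁ = foldr (λ l φ → litF l ∨ φ) false

  ⟦_⟧ : Clause n → Formula n
  ⟦ initial D ⟧       = start ⇒ ⋁ D
  ⟦ literal D ⟧       = true ⇒ ⋁ D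
  ⟦ positive a l′ l ⟧ = litF l′ ⇒ □ a (litF l)
  ⟦ negative a l′ l ⟧ = litF l′ ⇒ ¬′ □ a (litF l)

Satisfiable : {n : ℕ} → (p q r s : Fin 2) → List (Clause n) → Set₁
Satisfiable {n} p q r s T =
  Σ (KripkeModel n) λ M → Confluent p q r s M ×
    All (λ C → _⊨□*_ M (KripkeModel.w₀ M) ⟦ C ⟧) T

-- Clauses modulo simplification: disjunctions are compared as sets of literals.
data _≈_ {n : ℕ} : Clause n → Clause n → Set where
  initial  : ∀ {D D′} → D ∼[ set ] D′ → initial D ≈ initial D′
  literal  : ∀ {D D′} → D ∼[ set ] D′ → literal D ≈ literal D′
  positive : ∀ {a l′ l} → positive a l′ l ≈ positive a l′ l
  negative : ∀ {a l′ l} → negative a l′ l ≈ negative a l′ l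

infix 4 _≈_ _∋_

_∋_ : {n : ℕ} → List (Clause n) → Clause n → Set
S ∋ C = Any (C ≈_) S

module _ {n : ℕ} where

  symbolsOf : Clause n → List Symbol
  symbolsOf (initial D)       = map symbol D
  symbolsOf (literal D)       = map symbol D
  symbolsOf (positive _ l′ l) = symbol l′ ∷ symbol l ∷ []
  symbolsOf (negative _ l′ l) = symbol l′ ∷ symbol l ∷ []

  agentsOf : Clause n → List (Fin n)
  agentsOf (initial _)      = []
  agentsOf (literal _)      = []
  agentsOf (positive a _ _) = [ a ]
  agentsOf (negative a _ _) = [ a ]

  symbols : List (Clause n) → List Symbol
  symbols = concatMap symbolsOf

  agents : List (Clause n) → List (Fin n)
  agents = concatMap agentsOf

  literals : List (Clause n) → List Literal
  literals T = concatMap (λ x → var x ∷ nvar x ∷ []) (symbols T)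

  -- The pairs (a , l) for which there is a definition symbol pos a l.
  Defined : List (Clause n) → Fin n → Literal → Set
  Defined T a l = a ∈ agents T × l ∈ literals T

  -- Values of pos at pairs that are not Defined are irrelevant.
  record DefinitionSymbols (T : List (Clause n)) (pos : Fin n → Literal → Symbol) : Set where
    field
      fresh    : ∀ {a l} → Defined T a l → pos a l ∉ symbols T
      distinct : ∀ {a b l k} → Defined T a l → Defined T b k →
                 pos a l ≡ pos b k → a ≡ b × l ≡ k

  definitionClauses : (T : List (Clause n)) (pos : Fin n → Literal → Symbol) → List (Clause n)
  definitionClauses T pos =
    cartesianProductWith (λ a l → negative a (var (pos a l)) (∼ l)) (agents T) (literals T) ++
    cartesianProductWith (λ a l → positive a (nvar (pos a l)) (∼ l)) (agents T) (literals T)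

  -- D ∨ l is l ∷ D.  In nec1 and nec3 the list ls consists of the pairs (lᵢ′ , lᵢ).
  data KRule (S : List (Clause n)) : Clause n → Set where
    ires1 : ∀ {D D′ l} →
      S ∋ literal (l ∷ D) → S ∋ initial (∼ l ∷ D′) →
      KRule S (initial (D ++ D′))
    ires2 : ∀ {D D′ l} →
      S ∋ initial (l ∷ D) → S ∋ initial (∼ l ∷ D′) →
      KRule S (initial (D ++ D′))
    lres : ∀ {D D′ l} →
      S ∋ literal (l ∷ D) → S ∋ literal (∼ l ∷ D′) →
      KRule S (literal (D ++ D′))
    mres : ∀ {a l₁ l₂ l} →
      S ∋ positive a l₁ l → S ∋ negative a l₂ l →
      KRule S (literal (∼ l₁ ∷ ∼ l₂ ∷ []))
    nec1 : ∀ {a l′ l} {ls : List (Literal × Literal)} →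
      All (λ (lᵢ′ , lᵢ) → S ∋ positive a lᵢ′ (∼ lᵢ)) ls →
      S ∋ negative a l′ l →
      S ∋ literal (map proj₂ ls ++ [ l ]) →
      KRule S (literal (map (λ (lᵢ′ , _) → ∼ lᵢ′) ls ++ [ ∼ l′ ]))
    nec2 : ∀ {a l₁′ l₂′ l₃′ l₁ l₂} →
      S ∋ positive a l₁′ l₁ → S ∋ positive a l₂′ (∼ l₁) → S ∋ negative a l₃′ l₂ →
      KRule S (literal (∼ l₁′ ∷ ∼ l₂′ ∷ ∼ l₃′ ∷ []))
    nec3 : ∀ {a l′ l l₁} {ls : List (Literal × Literal)} →
      All (λ (lᵢ′ , lᵢ) → S ∋ positive a lᵢ′ (∼ lᵢ)) (l₁ ∷ ls) →
      S ∋ negative a l′ l →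
      S ∋ literal (map proj₂ (l₁ ∷ ls)) →
      KRule S (literal (map (λ (lᵢ′ , _) → ∼ lᵢ′) (l₁ ∷ ls) ++ [ ∼ l′ ]))

data Schema : Set where
  tautology axT axBan axB axD axC axF ax5 axG1 : Schema

schema : (p q r s : Fin 2) → Schema
schema 0F 0F 0F 0F = tautology
schema 0F 0F 0F 1F = axT
schema 0F 0F 1F 0F = axBan
schema 0F 0F 1F 1F = axB
schema 0F 1F 0F 0F = axT
schema 0F 1F 0F 1F = axD
schema 0F 1F 1F 0F = tautology
schema 0F 1F 1F 1F = axC
schema 1F 0F 0F 0F = axBan
schema 1F 0F 0F 1F = tautology
schema 1F 0F 1F 0F = axF
schema 1F 0F 1F 1F = ax5
schema 1F 1F 0F 0F = axB
schema 1F 1F 0F 1F = axC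
schema 1F 1F 1F 0F = ax5
schema 1F 1F 1F 1F = axG1

module _ {n : ℕ} (T : List (Clause n)) (pos : Fin n → Literal → Symbol) where

  -- A conclusion ¬ D ⇒ … is a clause only if D is a single literal d.
  -- The Defined premises exclude definition symbols for other pairs, in particular nested ones.
  data ExtraRule (S : List (Clause n)) : Schema → Clause n → Set where
    T₁ : ∀ {a l d} →
      S ∋ literal (l ∷ d ∷ []) →
      ExtraRule S axT (negative a (∼ d) (∼ l))
    T₂ : ∀ {a l l′} →
      S ∋ positive a l l′ →
      ExtraRule S axT (literal (∼ l ∷ l′ ∷ []))
    Ban₁ : ∀ {a l d} →
      S ∋ literal (l ∷ d ∷ []) →
      ExtraRule S axBan (positive a (∼ d) l)
    Ban₂ : ∀ {a l l′} →
      S ∋ negative a l (∼ l′) →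
      ExtraRule S axBan (literal (∼ l ∷ l′ ∷ []))
    B₁ : ∀ {a l d} → Defined T a l →
      S ∋ literal (l ∷ d ∷ []) →
      ExtraRule S axB (positive a (∼ d) (var (pos a l)))
    B₂ : ∀ {a l l′} →
      S ∋ positive a l l′ →
      ExtraRule S axB (positive a (∼ l′) (∼ l))
    D₁ : ∀ {a l l′} →
      S ∋ positive a l l′ →
      ExtraRule S axD (negative a l (∼ l′))
    C₁ : ∀ {a l l′} → Defined T a l′ →
      S ∋ positive a l l′ →
      ExtraRule S axC (positive a l (var (pos a l′)))
    C₂ : ∀ {a l l′} → Defined T a l →
      S ∋ positive a l l′ →
      ExtraRule S axC (negative a (var (pos a l)) (∼ l′))
    F₁ : ∀ {a l l′} →
      S ∋ negative a l (∼ l′) →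
      ExtraRule S axF (positive a l l′)
    Five₁ : ∀ {a l l′} → Defined T a l′ →
      S ∋ negative a l (∼ l′) →
      ExtraRule S ax5 (positive a l (var (pos a l′)))
    Five₂ : ∀ {a l l′} → Defined T a l →
      S ∋ positive a l l′ →
      ExtraRule S ax5 (positive a (var (pos a l)) l′)
    G1₁ : ∀ {a l l′} → Defined T a l → Defined T a l′ →
      S ∋ positive a l l′ →
      ExtraRule S axG1 (positive a (var (pos a l)) (var (pos a l′)))

  -- The conclusion may be added in any simplified form.
  data Step (p q r s : Fin 2) (S : List (Clause n)) : List (Clause n) → Set where
    step : ∀ {E E′} → KRule S E ⊎ ExtraRule S (schema p q r s) E → E ≈ E′ →
           Step p q r s S (E′ ∷ S)

  -- S occurs in a derivation from T iff it ends a finite derivation.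
  OccursInDerivation : (p q r s : Fin 2) → List (Clause n) → Set
  OccursInDerivation p q r s S = Star (Step p q r s) (T ++ definitionClauses T pos) S

HasContradiction : {n : ℕ} → List (Clause n) → Set
HasContradiction S = (initial [] ∈ S) ⊎ (literal [] ∈ S)

{-# OPTIONS --safe #-}
-- A model of T is turned into one model of every set derived from T: worlds and
-- accessibility are kept and each definition symbol pos a l is reinterpreted as ◇ₐ l.
-- Freshness keeps T true, and every rule preserves truth at all reachable worlds.
module Submission where

open import Defs
open import Data.Nat using (ℕ; _≥_)
open import Data.Fin using (Fin)
open import Data.Fin.Patterns using (0F; 1F)
open import Data.List using (List; []; _∷_; _++_; [_]; map)
open import Data.List.Membership.Propositional using (_∈_; find)
open import Data.List.Membership.Propositional.Properties
  using (∈-++⁺ˡ; ∈-++⁺ʳ; ∈-++⁻; ∈-map⁺; ∈-map⁻; ∈-concatMap⁺; ∈-concatMap⁻; ∈-cartesianProductWith⁻)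
open import Data.List.Relation.Unary.All using (All; []; _∷_; lookup; tabulate)
open import Data.List.Relation.Unary.All.Properties using (++⁺)
open import Data.List.Relation.Unary.Any as Any using (here; there)
open import Data.Product using (_×_; ∃-syntax; _,_; proj₁; proj₂)
open import Data.Sum using (inj₁; inj₂; [_,_]′)
open import Data.Unit using (⊤; tt)
open import Function using (_∘_)
open import Function.Bundles using (_⇔_; mk⇔; Equivalence)
open import Function.Construct.Symmetry using (⇔-sym)
open import Relation.Binary.Construct.Closure.ReflexiveTransitive using (Star; ε; _◅_; _◅◅_)
open import Relation.Binary.PropositionalEquality using (_≡_; refl; sym; trans; subst)
open import Relation.Nullary using (¬_; Stable; contradiction)

-- Classical semantics of literals and clauses.

≈-sym : ∀ {n} {C C′ : Clause n} → C ≈ C′ → C′ ≈ C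
≈-sym (initial D≈D′) = initial (⇔-sym D≈D′)
≈-sym (literal D≈D′) = literal (⇔-sym D≈D′)
≈-sym positive       = positive
≈-sym negative       = negative

module Semantics {n : ℕ} (M : KripkeModel n) where
  open KripkeModel M

  infix 4 _⊩_

  _⊩_ : World → Literal → Set
  w ⊩ l = _⊨_ M w (litF l)

  -- This licenses proofs by contradiction for literals without excluded middle: valuations are
  -- stable by assumption, and a triple negation collapses to a single one.
  ⊩-stable : ∀ {w} l → Stable (w ⊩ l)
  ⊩-stable {w} (var x) ¬¬px     = stable w x ¬¬px
  ⊩-stable (nvar x) ¬¬¬px px    = ¬¬¬px λ ¬px → ¬px px

  ∼⇒¬ : ∀ {w} l → w ⊩ ∼ l → ¬ w ⊩ l
  ∼⇒¬ (var x)  ¬px px  = ¬px px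
  ∼⇒¬ (nvar x) px  ¬px = ¬px px

  ¬⇒∼ : ∀ {w} l → ¬ w ⊩ l → w ⊩ ∼ l
  ¬⇒∼ (var x)      ¬px  = ¬px
  ¬⇒∼ {w} (nvar x) ¬¬px = stable w x ¬¬px

  -- A doubly negated existence, as weak as the encoded `∨`. Only membership in `D` enters, so
  -- simplification of disjunctions preserves it.
  Some : World → Disjunction → Set
  Some w D = ¬ (∀ {l} → l ∈ D → ¬ w ⊩ l)

  ⋁⇒Some : ∀ {w} D → _⊨_ M w (⋁ D) → Some w D
  ⋁⇒Some []      h none = h tt
  ⋁⇒Some (l ∷ D) h none = h (none (here refl) , λ d → ⋁⇒Some D d (none ∘ there))

  Some⇒⋁ : ∀ {w} D → Some w D → _⊨_ M w (⋁ D)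
  Some⇒⋁ []      some _ = some λ ()
  Some⇒⋁ (l ∷ D) some (¬l , ¬D) =
    ¬D (Some⇒⋁ D λ none → some λ { (here refl) → ¬l ; (there k∈D) → none k∈D })

  Some-map⁺ : ∀ {w D D′} → (∀ {l} → l ∈ D → l ∈ D′) → Some w D → Some w D′
  Some-map⁺ D⊆D′ some none = some (none ∘ D⊆D′)

  -- If nothing in `D ++ D′` holds, the first disjunction can be true only through `l` and the
  -- second only through `∼ l`, which clash.
  Some-resolve : ∀ {w l D D′} → Some w (l ∷ D) → Some w (∼ l ∷ D′) → Some w (D ++ D′)
  Some-resolve {l = l} {D} some some′ none = some λ
    { (here refl) hl → some′ λ
        { (here refl) h∼l → ∼⇒¬ l h∼l hl
        ; (there k∈D′)    → none (∈-++⁺ʳ D k∈D′) }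
    ; (there k∈D) → none (∈-++⁺ˡ k∈D) }

  Some-pair⁻ : ∀ {w l d} → Some w (l ∷ d ∷ []) → w ⊩ ∼ d → w ⊩ l
  Some-pair⁻ {l = l} {d} some h∼d = ⊩-stable l λ ¬l →
    some λ { (here refl) → ¬l ; (there (here refl)) → ∼⇒¬ d h∼d }

  Some-pair⁺ : ∀ {w l d} → (w ⊩ l → w ⊩ d) → Some w (∼ l ∷ d ∷ [])
  Some-pair⁺ {l = l} l⇒d none =
    none (here refl) (¬⇒∼ l λ hl → none (there (here refl)) (l⇒d hl))

  -- The conclusions of MRES and the NEC rules consist of complemented antecedents. If such a
  -- conclusion fails at a world, all antecedents hold there and every modal premise can be applied.
  none-∼⇒⊩ : ∀ {w D} → (∀ {l} → l ∈ D → ¬ w ⊩ l) → ∀ {l} → ∼ l ∈ D → w ⊩ l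
  none-∼⇒⊩ none {l} ∼l∈D = ⊩-stable l λ ¬l → none ∼l∈D (¬⇒∼ l ¬l)

  Necessary : Fin n → World → Literal → Set
  Necessary a w l = ∀ v → R a w v → v ⊩ l

  -- Doubly negated existence of a successor satisfying `l`. Being a negation it is stable, hence
  -- admissible as a truth value in a model.
  Possible : Fin n → World → Literal → Set
  Possible a w l = ¬ (∀ v → R a w v → ¬ v ⊩ l)

  possible⇒¬necessary : ∀ {a w} l → Possible a w l → ¬ Necessary a w (∼ l)
  possible⇒¬necessary l poss nec = poss λ v r → ∼⇒¬ l (nec v r)

  ¬necessary⇒possible : ∀ {a w} l → ¬ Necessary a w (∼ l) → Possible a w l
  ¬necessary⇒possible l ¬nec imp = ¬nec λ v r → ¬⇒∼ l (imp v r)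

  Holds : World → Clause n → Set
  Holds w (initial D)       = w ≡ w₀ → Some w D
  Holds w (literal D)       = Some w D
  Holds w (positive a l′ l) = w ⊩ l′ → Necessary a w l
  Holds w (negative a l′ l) = w ⊩ l′ → ¬ Necessary a w l

  -- The encoded implications carry double negations. They can be stripped because each right-hand
  -- side is a negation or, for a positive clause, a family of stable literals.
  ⊨⇒Holds : ∀ {w} C → _⊨_ M w ⟦ C ⟧ → Holds w C
  ⊨⇒Holds (initial D) h w≡w₀ none       = h (w≡w₀ , λ d → ⋁⇒Some D d none)
  ⊨⇒Holds (literal D) h none            = h (tt , λ d → ⋁⇒Some D d none)
  ⊨⇒Holds (positive a l′ l) h hl′ v r   =
    ⊩-stable l λ ¬l → h (hl′ , λ nec → ¬l (nec v r))
  ⊨⇒Holds (negative a l′ l) h hl′ nec   = h (hl′ , λ ¬nec → ¬nec nec)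

  Holds⇒⊨ : ∀ {w} C → Holds w C → _⊨_ M w ⟦ C ⟧
  Holds⇒⊨ (initial D) h (w≡w₀ , ¬D)         = ¬D (Some⇒⋁ D (h w≡w₀))
  Holds⇒⊨ (literal D) h (_ , ¬D)            = ¬D (Some⇒⋁ D h)
  Holds⇒⊨ (positive a l′ l) h (hl′ , ¬nec)  = ¬nec (h hl′)
  Holds⇒⊨ (negative a l′ l) h (hl′ , ¬¬nec) = ¬¬nec (h hl′)

  Holds-resp-≈ : ∀ {w C C′} → C ≈ C′ → Holds w C → Holds w C′
  Holds-resp-≈ (initial D≈D′) h w≡w₀ = Some-map⁺ (Equivalence.to D≈D′) (h w≡w₀)
  Holds-resp-≈ (literal D≈D′) h      = Some-map⁺ (Equivalence.to D≈D′) h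
  Holds-resp-≈ positive h            = h
  Holds-resp-≈ negative h            = h

  Valid : Clause n → Set
  Valid C = ∀ w → Reachable M w₀ w → Holds w C

  Valid-resp-≈ : ∀ {C C′} → C ≈ C′ → Valid C → Valid C′
  Valid-resp-≈ C≈C′ valid w r = Holds-resp-≈ C≈C′ (valid w r)

  ∋⇒Valid : ∀ {S C} → All Valid S → S ∋ C → Valid C
  ∋⇒Valid valid S∋C with find S∋C
  ... | C′ , C′∈S , C≈C′ = Valid-resp-≈ (≈-sym C≈C′) (lookup valid C′∈S)

  reachable-step : ∀ {u w v a} → Reachable M u w → R a w v → Reachable M u v
  reachable-step r s = r ◅◅ ((_ , s) ◅ ε)

  -- Soundness of the rules for the basic modal logic.

  NecessarilyRefuted : Fin n → List (Literal × Literal) → Set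
  NecessarilyRefuted a ls = All (λ (lᵢ′ , lᵢ) → Valid (positive a lᵢ′ (∼ lᵢ))) ls

  -- Once the antecedents hold at `w`, the positive premises exclude every `lᵢ` at every successor,
  -- so a literal clause can be true there only through some other literal.
  successor-refutes : ∀ {a w v} ls → NecessarilyRefuted a ls →
    Reachable M w₀ w → R a w v → (∀ {k} → k ∈ map proj₁ ls → w ⊩ k) →
    ∀ {k} → k ∈ map proj₂ ls → ¬ v ⊩ k
  successor-refutes ((l′ , l) ∷ ls) (h ∷ hs) r s hls (here refl) =
    ∼⇒¬ l (h _ r (hls (here refl)) _ s)
  successor-refutes (_ ∷ ls) (h ∷ hs) r s hls (there k∈) =
    successor-refutes ls hs r s (hls ∘ there) k∈

  none-∼⇒all : ∀ {w} (ls : List (Literal × Literal)) {l′} →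
    (∀ {k} → k ∈ map (λ (lᵢ′ , _) → ∼ lᵢ′) ls ++ [ ∼ l′ ] → ¬ w ⊩ k) →
    (∀ {k} → k ∈ map proj₁ ls → w ⊩ k) × w ⊩ l′
  none-∼⇒all ls {l′} none = all , none-∼⇒⊩ none (∈-++⁺ʳ (map _ ls) (here refl))
    where
    all : ∀ {k} → k ∈ map proj₁ ls → _ ⊩ k
    all k∈ with ∈-map⁻ proj₁ k∈
    ... | _ , l∈ls , refl = none-∼⇒⊩ none (∈-++⁺ˡ (∈-map⁺ _ l∈ls))

  premises-valid : ∀ {S a} (ls : List (Literal × Literal)) → All Valid S →
    All (λ (lᵢ′ , lᵢ) → S ∋ positive a lᵢ′ (∼ lᵢ)) ls → NecessarilyRefuted a ls
  premises-valid ls valid premises = tabulate λ l∈ls → ∋⇒Valid valid (lookup premises l∈ls)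

  KRule-sound : ∀ {S E} → All Valid S → KRule S E → Valid E
  KRule-sound valid (ires1 P Q) w r w≡w₀ =
    Some-resolve (∋⇒Valid valid P w r) (∋⇒Valid valid Q w r w≡w₀)
  KRule-sound valid (ires2 P Q) w r w≡w₀ =
    Some-resolve (∋⇒Valid valid P w r w≡w₀) (∋⇒Valid valid Q w r w≡w₀)
  KRule-sound valid (lres P Q) w r =
    Some-resolve (∋⇒Valid valid P w r) (∋⇒Valid valid Q w r)
  KRule-sound valid (mres P Q) w r none =
    ∋⇒Valid valid Q w r (none-∼⇒⊩ none (there (here refl)))
      (∋⇒Valid valid P w r (none-∼⇒⊩ none (here refl)))
  KRule-sound valid (nec1 {l = l} {ls} Ps Q D) w r none =
    let hls , hl′ = none-∼⇒all ls none in
    -- The literal clause holds at each successor too, and `l` is the only disjunct left; so `l` is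
    -- necessary at `w`, against the negative premise.
    ∋⇒Valid valid Q w r hl′ λ v s → ⊩-stable l λ ¬l →
      ∋⇒Valid valid D v (reachable-step r s) λ k∈ →
        [ successor-refutes ls (premises-valid ls valid Ps) r s hls
        , (λ { (here refl) → ¬l }) ]′ (∈-++⁻ (map proj₂ ls) k∈)
  KRule-sound valid (nec2 {l₁ = l₁} P Q N) w r none =
    -- A successor would satisfy both `l₁` and its complement. Hence there is none, and the box in
    -- the negative premise is vacuously true.
    ∋⇒Valid valid N w r (none-∼⇒⊩ none (there (there (here refl)))) λ v s →
      contradiction
        (∋⇒Valid valid P w r (none-∼⇒⊩ none (here refl)) v s)
        (∼⇒¬ l₁ (∋⇒Valid valid Q w r (none-∼⇒⊩ none (there (here refl))) v s))
  KRule-sound valid (nec3 {l₁ = l₁} {ls} Ps Q D) w r none =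
    let hls , hl′ = none-∼⇒all (l₁ ∷ ls) none in
    -- Here all disjuncts of the literal clause are excluded, so again no successor exists and the
    -- box is vacuously true.
    ∋⇒Valid valid Q w r hl′ λ v s → contradiction
      (λ {k} → successor-refutes (l₁ ∷ ls) (premises-valid (l₁ ∷ ls) valid Ps) r s hls {k})
      (∋⇒Valid valid D v (reachable-step r s))

  -- First-order frame conditions of the confluence axioms.

  FrameCondition : Schema → Set
  FrameCondition tautology = ⊤
  FrameCondition axT       = ∀ {a} u → R a u u
  FrameCondition axBan     = ∀ {a u v} → R a u v → u ≡ v
  FrameCondition axB       = ∀ {a u v} → R a u v → R a v u
  FrameCondition axD       = ∀ {a} u → ∃[ v ] R a u v
  FrameCondition axC       = ∀ {a u v} → R a u v → ∃[ t ] R a u t × R a v t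
  FrameCondition axF       = ∀ {a u v t} → R a u v → R a u t → v ≡ t
  FrameCondition ax5       = ∀ {a u v t} → R a u v → R a u t → R a v t
  FrameCondition axG1      = ∀ {a u v t} → R a u v → R a u t → ∃[ z ] R a v z × R a t z

  -- A zero exponent turns a side of the confluence diamond into an equality, collapsing it to a
  -- familiar property such as reflexivity or symmetry. Reflecting the diamond exchanges `(p,q)`
  -- with `(r,s)`, so one condition serves both tuples.
  Confluent⇒FrameCondition : ∀ p q r s → Confluent p q r s M → FrameCondition (schema p q r s)
  Confluent⇒FrameCondition 0F 0F 0F 0F conf = tt
  Confluent⇒FrameCondition 0F 0F 0F 1F conf u with conf _ u u u refl refl
  ... | _ , refl , uRu = uRu
  Confluent⇒FrameCondition 0F 0F 1F 0F conf uRv with conf _ _ _ _ refl uRv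
  ... | _ , u≡t , v≡t = trans u≡t (sym v≡t)
  Confluent⇒FrameCondition 0F 0F 1F 1F conf uRv with conf _ _ _ _ refl uRv
  ... | _ , refl , vRu = vRu
  Confluent⇒FrameCondition 0F 1F 0F 0F conf u with conf _ u u u refl refl
  ... | _ , uRu , refl = uRu
  Confluent⇒FrameCondition 0F 1F 0F 1F conf u with conf _ u u u refl refl
  ... | v , uRv , _ = v , uRv
  Confluent⇒FrameCondition 0F 1F 1F 0F conf = tt
  Confluent⇒FrameCondition 0F 1F 1F 1F conf uRv = conf _ _ _ _ refl uRv
  Confluent⇒FrameCondition 1F 0F 0F 0F conf uRv with conf _ _ _ _ uRv refl
  ... | _ , v≡t , u≡t = trans u≡t (sym v≡t)
  Confluent⇒FrameCondition 1F 0F 0F 1F conf = tt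
  Confluent⇒FrameCondition 1F 0F 1F 0F conf uRv uRt with conf _ _ _ _ uRv uRt
  ... | _ , v≡z , t≡z = trans v≡z (sym t≡z)
  -- The successors are passed in swapped order because the remaining edge starts at the second one.
  Confluent⇒FrameCondition 1F 0F 1F 1F conf uRv uRt with conf _ _ _ _ uRt uRv
  ... | _ , refl , vRt = vRt
  Confluent⇒FrameCondition 1F 1F 0F 0F conf uRv with conf _ _ _ _ uRv refl
  ... | _ , vRu , refl = vRu
  Confluent⇒FrameCondition 1F 1F 0F 1F conf uRv with conf _ _ _ _ uRv refl
  ... | t , vRt , uRt = t , uRt , vRt
  Confluent⇒FrameCondition 1F 1F 1F 0F conf uRv uRt with conf _ _ _ _ uRv uRt
  ... | _ , vRt , refl = vRt
  Confluent⇒FrameCondition 1F 1F 1F 1F conf uRv uRt = conf _ _ _ _ uRv uRt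

  -- Soundness of the additional rules and of derivations.

  Interprets : List (Clause n) → (Fin n → Literal → Symbol) → Set
  Interprets T pos = ∀ {a l} → Defined T a l → ∀ w → w ⊩ var (pos a l) ⇔ Possible a w l

  module _ {T : List (Clause n)} {pos : Fin n → Literal → Symbol} (interprets : Interprets T pos) where

    pos⁺ : ∀ {a l w v} → Defined T a l → R a w v → v ⊩ l → w ⊩ var (pos a l)
    pos⁺ def s hl = Equivalence.from (interprets def _) λ imp → imp _ s hl

    pos⁻ : ∀ {a l w} → Defined T a l → w ⊩ var (pos a l) → Possible a w l
    pos⁻ def = Equivalence.to (interprets def _)

    ExtraRule-sound : ∀ {S σ E} → FrameCondition σ → All Valid S → ExtraRule T pos S σ E → Valid E
    ExtraRule-sound refl′ valid (T₁ {l = l} P) w r h∼d nec =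
      ∼⇒¬ l (nec w (refl′ w)) (Some-pair⁻ (∋⇒Valid valid P w r) h∼d)
    ExtraRule-sound refl′ valid (T₂ P) w r =
      Some-pair⁺ λ hl → ∋⇒Valid valid P w r hl w (refl′ w)
    ExtraRule-sound ban valid (Ban₁ {l = l} P) w r h∼d v s =
      subst (_⊩ l) (ban s) (Some-pair⁻ (∋⇒Valid valid P w r) h∼d)
    ExtraRule-sound ban valid (Ban₂ {l′ = l′} P) w r = Some-pair⁺ λ hl → ⊩-stable l′ λ ¬l′ →
      -- Every successor of `w` is `w` itself, so failure of `l′` at `w` would make `∼ l′`
      -- necessary.
      ∋⇒Valid valid P w r hl λ v s → ¬⇒∼ l′ λ hl′ → ¬l′ (subst (_⊩ l′) (sym (ban s)) hl′)
    ExtraRule-sound symm valid (B₁ def P) w r h∼d v s =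
      pos⁺ def (symm s) (Some-pair⁻ (∋⇒Valid valid P w r) h∼d)
    ExtraRule-sound symm valid (B₂ {l = l} {l′} P) w r h∼l′ v s = ¬⇒∼ l λ hl →
      -- If `l` held at `v`, the premise at `v` would send `l′` back to `w` along the symmetric
      -- edge.
      ∼⇒¬ l′ h∼l′ (∋⇒Valid valid P v (reachable-step r s) hl w (symm s))
    ExtraRule-sound serial valid (D₁ {l′ = l′} P) w r hl nec =
      let v , s = serial w in
      ∼⇒¬ l′ (nec v s) (∋⇒Valid valid P w r hl v s)
    ExtraRule-sound conv valid (C₁ def P) w r hl v s =
      let t , wRt , vRt = conv s in
      pos⁺ def vRt (∋⇒Valid valid P w r hl t wRt)
    ExtraRule-sound conv valid (C₂ {l′ = l′} def P) w r hpos nec =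
      pos⁻ def hpos λ v s hl →
        -- The common successor `t` receives `l′` from the premise at `v` and `∼ l′` from the
        -- assumed necessity at `w`.
        let t , wRt , vRt = conv s in
        ∼⇒¬ l′ (nec t wRt) (∋⇒Valid valid P v (reachable-step r s) hl t vRt)
    ExtraRule-sound fun valid (F₁ {l′ = l′} P) w r hl v s = ⊩-stable l′ λ ¬l′ →
      -- `Possible` yields its witness `t` only while proving a contradiction, hence the preceding
      -- use of stability. Functionality identifies `t` with `v`.
      ¬necessary⇒possible l′ (∋⇒Valid valid P w r hl) λ t s′ hl′ →
        ¬l′ (subst (_⊩ l′) (fun s′ s) hl′)
    ExtraRule-sound eucl valid (Five₁ {a} {l′ = l′} def P) w r hl v s =
      ⊩-stable (var (pos a l′)) λ ¬pos →
        ¬necessary⇒possible l′ (∋⇒Valid valid P w r hl) λ t s′ hl′ →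
          ¬pos (pos⁺ def (eucl s s′) hl′)
    ExtraRule-sound eucl valid (Five₂ {l′ = l′} def P) w r hpos v s = ⊩-stable l′ λ ¬l′ →
      pos⁻ def hpos λ t s′ hl →
        ¬l′ (∋⇒Valid valid P t (reachable-step r s′) hl v (eucl s′ s))
    ExtraRule-sound conf valid (G1₁ {a} {l′ = l′} def def′ P) w r hpos v s =
      ⊩-stable (var (pos a l′)) λ ¬pos → pos⁻ def hpos λ t s′ hl →
        -- The witness `t` for `pos a l` and the given successor `v` meet in `z`; the premise at `t`
        -- puts `l′` there, which makes `pos a l′` true at `v`.
        let z , tRz , vRz = conf s′ s in
        ¬pos (pos⁺ def′ vRz (∋⇒Valid valid P t (reachable-step r s′) hl z tRz))

    derivation-sound : ∀ {p q r s S S′} → FrameCondition (schema p q r s) → All Valid S →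
      Star (Step T pos p q r s) S S′ → All Valid S′
    derivation-sound frame valid ε = valid
    derivation-sound frame valid (step rule E≈E′ ◅ steps) = derivation-sound frame
      (Valid-resp-≈ E≈E′ ([ KRule-sound valid , ExtraRule-sound frame valid ]′ rule) ∷ valid) steps

    definitionClauses-valid : All Valid (definitionClauses T pos)
    definitionClauses-valid = ++⁺ (tabulate negatives) (tabulate positives)
      where
      negatives : ∀ {C} → C ∈ _ → Valid C
      negatives C∈ w r with ∈-cartesianProductWith⁻
        (λ a l → negative a (var (pos a l)) (∼ l)) (agents T) (literals T) C∈
      ... | a , l , a∈ , l∈ , refl = λ hpos → possible⇒¬necessary l (pos⁻ (a∈ , l∈) hpos)
      positives : ∀ {C} → C ∈ _ → Valid C
      positives C∈ w r with ∈-cartesianProductWith⁻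
        (λ a l → positive a (nvar (pos a l)) (∼ l)) (agents T) (literals T) C∈
      ... | a , l , a∈ , l∈ , refl = λ ¬pos v s → ¬⇒∼ l λ hl → ¬pos (pos⁺ (a∈ , l∈) s hl)

-- Reinterpretation of the definition symbols.

literals⇒symbols : ∀ {n} (T : List (Clause n)) {l} → l ∈ literals T → symbol l ∈ symbols T
literals⇒symbols T l∈ with find (∈-concatMap⁻ _ {xs = symbols T} l∈)
... | x , x∈ , here refl         = x∈
... | x , x∈ , there (here refl) = x∈

module Expansion {n : ℕ} {T : List (Clause n)} {pos : Fin n → Literal → Symbol}
                 (definitions : DefinitionSymbols T pos) (M : KripkeModel n) where
  open KripkeModel M
  open DefinitionSymbols definitions
  module Old = Semantics M

  -- Symbols that are neither in T nor definition symbols become true.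
  π′ : World → Symbol → Set
  π′ w x = (x ∈ symbols T → π w x) ×
           (∀ {a l} → Defined T a l → x ≡ pos a l → Old.Possible a w l)

  expansion : KripkeModel n
  expansion = record
    { World  = World
    ; w₀     = w₀
    ; R      = R
    ; π      = π′
    -- Both components are implications into stable propositions: an old truth value and a negation.
    ; stable = λ w x ¬¬π′ →
        (λ x∈ → stable w x λ ¬π → ¬¬π′ λ h → ¬π (proj₁ h x∈)) ,
        (λ def x≡ imp → ¬¬π′ λ h → proj₂ h def x≡ imp)
    }

  module New = Semantics expansion

  -- By freshness no symbol of `T` is a definition symbol, so the second component of `π′` is
  -- vacuous and the first returns the old value.
  atom-agrees : ∀ {w x} → x ∈ symbols T → π w x ⇔ π′ w x
  atom-agrees x∈ = mk⇔
    (λ h → (λ _ → h) , λ { def refl → contradiction x∈ (fresh def) })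
    (λ h → proj₁ h x∈)

  literal-agrees : ∀ {w} l → symbol l ∈ symbols T → w Old.⊩ l ⇔ w New.⊩ l
  literal-agrees (var x)  x∈ = atom-agrees x∈
  literal-agrees (nvar x) x∈ =
    mk⇔ (_∘ Equivalence.from (atom-agrees x∈)) (_∘ Equivalence.to (atom-agrees x∈))

  Some-agrees : ∀ {w} D → (∀ {x} → x ∈ map symbol D → x ∈ symbols T) →
                Old.Some w D → New.Some w D
  Some-agrees D sub some none = some λ {l} l∈D →
    none l∈D ∘ Equivalence.to (literal-agrees l (sub (∈-map⁺ symbol l∈D)))

  Holds-agrees : ∀ {w} C → (∀ {x} → x ∈ symbolsOf C → x ∈ symbols T) →
                 Old.Holds w C → New.Holds w C
  Holds-agrees (initial D) sub h w≡w₀ = Some-agrees D sub (h w≡w₀)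
  Holds-agrees (literal D) sub h      = Some-agrees D sub h
  Holds-agrees (positive a l′ l) sub h hl′ v r =
    Equivalence.to (literal-agrees l (sub (there (here refl))))
      (h (Equivalence.from (literal-agrees l′ (sub (here refl))) hl′) v r)
  Holds-agrees (negative a l′ l) sub h hl′ nec =
    h (Equivalence.from (literal-agrees l′ (sub (here refl))) hl′) λ v r →
      Equivalence.from (literal-agrees l (sub (there (here refl)))) (nec v r)

  T-valid : All Old.Valid T → All New.Valid T
  T-valid valid = tabulate λ {C} C∈T w r →
    Holds-agrees C (λ x∈ → ∈-concatMap⁺ symbolsOf (Any.map (λ { refl → x∈ }) C∈T))
      (lookup valid C∈T w r)

  -- `π′` must speak of possibility in the old model to avoid circularity. Both notions agree here
  -- because `l` is built from a symbol of `T`, on which old and new valuations coincide.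
  interprets : New.Interprets T pos
  interprets {a} {l} def@(a∈ , l∈) w = mk⇔
    (λ h imp → proj₂ h def refl λ v r hl → imp v r (Equivalence.to agrees hl))
    (λ poss → (λ x∈ → contradiction x∈ (fresh def)) ,
              λ {_} {_} def′ eq imp → poss (respects def′ eq imp))
    where
    agrees : ∀ {v} → v Old.⊩ l ⇔ v New.⊩ l
    agrees = literal-agrees l (literals⇒symbols T l∈)
    respects : ∀ {b k} → Defined T b k → pos a l ≡ pos b k →
      (∀ v → R b w v → ¬ v Old.⊩ k) → ∀ v → R a w v → ¬ v New.⊩ l
    respects def′ eq imp v r hl with distinct def def′ eq
    -- Distinctness ensures that `π′` imposes on `pos a l` no condition coming from another pair.
    ... | refl , refl = imp v r (Equivalence.from agrees hl)

-- Satisfiability along derivations.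

derivation-satisfiable : ∀ {p q r s n} {T : List (Clause n)} {pos} → DefinitionSymbols T pos →
  Satisfiable p q r s T → ∀ {S} → OccursInDerivation T pos p q r s S → Satisfiable p q r s S
derivation-satisfiable {p} {q} {r} {s} {T = T} definitions (M , conf , sat) derivation =
  -- `conf` carries over unchanged, since confluence mentions only the worlds and relations kept by
  -- `expansion`.
  expansion , conf , tabulate λ {C} C∈S w reach → New.Holds⇒⊨ C (lookup valid C∈S w reach)
  where
  open Expansion definitions M
  valid : All New.Valid _
  valid = New.derivation-sound {T = T} interprets
    (New.Confluent⇒FrameCondition p q r s conf)
    (++⁺ (T-valid (tabulate λ {C} C∈T w reach → Old.⊨⇒Holds C (lookup sat C∈T w reach)))
         (New.definitionClauses-valid {T = T} interprets))
    derivation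

-- The empty path reaches `w₀`, where both `start` and `true` hold, so the empty disjunction would
-- have to hold as well.
contradiction⇒unsatisfiable : ∀ {p q r s n} {S : List (Clause n)} →
  HasContradiction S → ¬ Satisfiable p q r s S
contradiction⇒unsatisfiable (inj₁ C∈S) (M , _ , sat) = lookup sat C∈S _ ε (refl , λ ¬⊤ → ¬⊤ tt)
contradiction⇒unsatisfiable (inj₂ C∈S) (M , _ , sat) = lookup sat C∈S _ ε (tt , λ ¬⊤ → ¬⊤ tt)

theorem1 : (p q r s : Fin 2) (n : ℕ) → n ≥ 1 →
    (T : List (Clause n)) (pos : Fin n → Literal → Symbol) → DefinitionSymbols T pos →
    (Satisfiable p q r s T →
    ∀ S → OccursInDerivation T pos p q r s S → Satisfiable p q r s S)
    × ((∃[ S ] OccursInDerivation T pos p q r s S × HasContradiction S) →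
    ¬ Satisfiable p q r s T)
theorem1 p q r s n n≥1 T pos definitions =
  (λ sat S derivation → derivation-satisfiable definitions sat derivation) ,
  λ (S , derivation , ⊥∈S) sat →
    contradiction⇒unsatisfiable {p} {q} {r} {s} ⊥∈S (derivation-satisfiable definitions sat derivation)
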